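{- Let $\Gamma$ be a finite set of terms and $c$ a term such that $\Gamma\vdash c$ is derivable in OGA. For every assignment $\sigma$ of closed terms to variables, if $h\sigma$ is $\omega$-true for every hypothesis $h\in\Gamma$, then $c\sigma$ is $\omega$-true.
   Context: **Syntax.** Terms: $t::=v_i\mid\bot\mid\mathbf 0\mid\mathbf S t\mid t=t\mid\neg t\mid t\lor t\mid\lambda t\mid t\cdot t\mid\mathcal R\mid\mathcal A$ ($v_i$, $i\in\mathbb N$, de Bruijn variables; $\lambda$ is the only binder; application associates to the left). A term is well-formed (wf) if generated by this grammar; a sentence is a closed wf term when truth is concerned. $\bot$ is a divergent constant, $\mathcal R$ the primitive recursor, $\mathcal A$ the universal quantifier. Abbreviations: $t\,\mathsf N$ is $t=t$; $t\,\mathsf B$ is $t\lor\neg t$; $t\ne u$ is $\neg(t=u)$; $t\land u$ is $\neg(\neg t\lor\neg u)$; $t\to u$ is $\neg t\lor u$; $\underline n=\mathbf S^n\mathbf 0$. $\uparrow$ shifts all free indices up by one; $b[t]$ is the $\beta$-instance substituting $t$ for the outermost bound variable of $b$; $[v\mapsto s]$ is capture-avoiding substitution for a free variable; $\mathrm{fv}$ is the set of free variables. **Head steps** $\triangleright$: $(\lambda b)\cdot t\triangleright b[t]$; $\mathcal R\cdot g\cdot h\cdot\mathbf 0\triangleright g$; $\mathcal R\cdot g\cdot h\cdot(\mathbf S\underline n)\triangleright h\cdot\underline n\cdot(\mathcal R\cdot g\cdot h\cdot\underline n)$; if $t\triangleright t'$ then $t\cdot u\triangleright t'\cdot u$. **Rules.**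 Judgments are $\Gamma\vdash c$, $\Gamma$ a finite set of wf terms, $c$ a wf term (all terms in rules are wf). A proof is a finite list of judgments each following from earlier entries by one rule; $\Gamma\vdash c$ is derivable if it occurs in a proof. Rules ("$\Rightarrow$" from premises to conclusion, "$\Leftrightarrow$" both directions; $\Gamma$ is the context of a judgment when none is shown): $\Gamma,c\vdash c$; $\Gamma\vdash c\Rightarrow\Gamma,a\vdash c$; $\Gamma\vdash a$ and $\Gamma,a\vdash c\Rightarrow\Gamma\vdash c$; $\Gamma\vdash c\Rightarrow[v\mapsto s]\Gamma\vdash[v\mapsto s]c$; $\vdash a\Leftrightarrow\ \vdash a=\underline1$; $\vdash\neg a\Leftrightarrow\ \vdash a=\underline0$; $\vdash\neg a,\ \vdash a\Rightarrow\ \vdash c$; $\vdash a\Leftrightarrow\ \vdash\neg\neg a$; $\vdash a\Rightarrow\ \vdash a\lor b$; $\vdash b\Rightarrow\ \vdash a\lor b$; $\vdash\neg a,\ \vdash\neg b\Rightarrow\ \vdash\neg(a\lor b)$; $\vdash a\lor b,\ \Gamma,a\vdash c,\ \Gamma,b\vdash c\Rightarrow\ \vdash c$; $\vdash\neg(a\lor b)\Rightarrow\ \vdash\neg a$; $\vdash\neg(a\lor b)\Rightarrow\ \vdash\neg b$; $\vdash a\,\mathsf N\Leftrightarrow\ \vdash a=a$; $\vdash a=b\Rightarrow\ \vdash b=a$; $\vdash a=b,\ \vdash[v\mapsto a]p\Rightarrow\ \vdash[v\mapsto b]p$; $\vdash a\ne b\Rightarrow\ \vdash b\ne a$; $\vdash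 a\,\mathsf N,\ \vdash b\,\mathsf N\Rightarrow\ \vdash(a=b)\,\mathsf B$; $\vdash(a=b)\,\mathsf B\Rightarrow\ \vdash(a\,\mathsf N)\land(b\,\mathsf N)$; $\vdash\mathbf 0\,\mathsf N$; $\vdash a\,\mathsf N\Leftrightarrow\ \vdash(\mathbf S a)\,\mathsf N$; $\vdash a\,\mathsf N\Rightarrow\ \vdash\mathbf S a\ne\mathbf 0$; $\vdash a\ne b\Leftrightarrow\ \vdash\mathbf S a\ne\mathbf S b$; $\vdash\mathbf S a=\mathbf S b\Rightarrow\ \vdash a=b$; $\vdash\bot\,\mathsf N\Rightarrow\ \vdash p$; induction: $\vdash[v_i\mapsto\mathbf 0]c$, $\ v_i\,\mathsf N,c,\Gamma\vdash[v_i\mapsto\mathbf S v_i]c$, $\ \vdash a\,\mathsf N\Rightarrow\ \vdash[v_i\mapsto a]c$ if $v_i\notin\mathrm{fv}(\Gamma)$; conversion, for $c\triangleright c'$: $\vdash c'\Rightarrow\ \vdash c$; $\vdash c\Rightarrow\ \vdash c'$; $\vdash\neg c\Rightarrow\ \vdash\neg c'$; $\vdash c'\,\mathsf N\Rightarrow\ \vdash c=c'$; $\vdash m\,\mathsf N,\ \vdash(h\cdot m\cdot(\mathcal R\cdot g\cdot h\cdot m))\,\mathsf N\Rightarrow\ \vdash\mathcal R\cdot g\cdot h\cdot(\mathbf S m)=h\cdot m\cdot(\mathcal R\cdot g\cdot h\cdot m)$; $v_0\,\mathsf N,\uparrow\Gamma\vdash\uparrow f\cdot v_0\Rightarrow\Gamma\vdash\mathcal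 A\cdot f$; $\vdash\mathcal A\cdot f,\ \vdash a\,\mathsf N\Rightarrow\ \vdash f\cdot a$; $\vdash\neg(f\cdot a),\ \vdash a\,\mathsf N\Rightarrow\ \vdash\neg(\mathcal A\cdot f)$; $\Gamma\vdash\neg(\mathcal A\cdot f)$ and $v_0\,\mathsf N,\neg(\uparrow f\cdot v_0),\uparrow\Gamma\vdash\uparrow c\Rightarrow\Gamma\vdash c$. These are the rules of RGA. OGA has these and the rule ATI: $\Gamma\vdash\mathcal A\cdot(\lambda((\uparrow u\cdot v_0)\,\mathsf B))\Rightarrow\Gamma\vdash(\mathcal A\cdot u)\,\mathsf B$. **$\omega$-truth.** Let $\Downarrow$ be the least relation between closed terms and naturals such that: $\mathbf 0\Downarrow0$; $t\Downarrow n$ implies $\mathbf S t\Downarrow n+1$; if $t\Downarrow m$, $u\Downarrow n$ then $(t=u)\Downarrow1$ when $m=n$ and $(t=u)\Downarrow0$ when $m\ne n$; $t\Downarrow1$ implies $\neg t\Downarrow0$, and $t\Downarrow0$ implies $\neg t\Downarrow1$; $t\lor u\Downarrow1$ if $t\Downarrow1$ or $u\Downarrow1$, and $t\lor u\Downarrow0$ if $t\Downarrow0$ and $u\Downarrow0$; for any finite list of arguments $\vec s$: $b[t]\cdot\vec s\Downarrow n$ implies $(\lambda b)\cdot t\cdot\vec s\Downarrow n$; if $a\Downarrow0$ and $g\cdot\vec s\Downarrow n$ then $\mathcal R\cdot g\cdot h\cdot a\cdot\vec s\Downarrow n$; if $a\Downarrow k+1$ and $h\cdot\underline k\cdot(\mathcal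 R\cdot g\cdot h\cdot\underline k)\cdot\vec s\Downarrow n$ then $\mathcal R\cdot g\cdot h\cdot a\cdot\vec s\Downarrow n$; $\mathcal A\cdot f\Downarrow1$ if $f\cdot\underline k\Downarrow1$ for all $k\in\mathbb N$; $\mathcal A\cdot f\Downarrow0$ if $f\cdot\underline k\Downarrow0$ for some $k$. A closed term $t$ is $\omega$-true if $t\Downarrow1$ and $\omega$-false if $t\Downarrow0$. -}

module Defs where

open import Data.Bool using (if_then_else_)
open import Data.Empty using (⊥)
open import Data.List using (List; []; _∷_; foldl; map)
open import Data.List.Membership.Propositional using (_∈_)
open import Data.List.Relation.Binary.BagAndSetEquality using (_∼[_]_; set)
open import Data.List.Relation.Unary.All using (All)
open import Data.List.Relation.Unary.Any using (Any)
open import Data.Nat using (ℕ; zero; suc; _≡ᵇ_)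
open import Data.Product using (∃; _×_)
open import Data.Sum using (_⊎_)
open import Relation.Binary.PropositionalEquality using (_≡_; _≢_)
open import Relation.Nullary using (¬_)

infixl 9 _·_ _·*_
infix  8 ¬ᵗ_
infix  7 _≐_ _≠_
infix  6 _𝖭 _𝖡
infixr 5 _∨_ _∧_
infix  4 _▷_ _⇓_ _⊢_ _≈_ _∈fv_

data Term : Set where
  var  : ℕ → Term
  ⊥ᵗ   : Term
  𝟎    : Term
  𝐒    : Term → Term
  _≐_  : Term → Term → Term
  ¬ᵗ_  : Term → Term
  _∨_  : Term → Term → Term
  ƛ    : Term → Term
  _·_  : Term → Term → Term
  ℛ    : Term
  𝒜    : Term

_𝖭 : Term → Term
t 𝖭 = t ≐ t

_𝖡 : Term → Term
t 𝖡 = t ∨ ¬ᵗ t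

_≠_ : Term → Term → Term
t ≠ u = ¬ᵗ (t ≐ u)

_∧_ : Term → Term → Term
t ∧ u = ¬ᵗ (¬ᵗ t ∨ ¬ᵗ u)

num : ℕ → Term
num zero    = 𝟎
num (suc n) = 𝐒 (num n)

_·*_ : Term → List Term → Term
_·*_ = foldl _·_

extʳ : (ℕ → ℕ) → ℕ → ℕ
extʳ ρ zero    = zero
extʳ ρ (suc i) = suc (ρ i)

ren : (ℕ → ℕ) → Term → Term
ren ρ (var i) = var (ρ i)
ren ρ ⊥ᵗ      = ⊥ᵗ
ren ρ 𝟎       = 𝟎
ren ρ (𝐒 t)   = 𝐒 (ren ρ t)
ren ρ (t ≐ u) = ren ρ t ≐ ren ρ u
ren ρ (¬ᵗ t)  = ¬ᵗ ren ρ t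
ren ρ (t ∨ u) = ren ρ t ∨ ren ρ u
ren ρ (ƛ b)   = ƛ (ren (extʳ ρ) b)
ren ρ (t · u) = ren ρ t · ren ρ u
ren ρ ℛ       = ℛ
ren ρ 𝒜       = 𝒜

↑ : Term → Term
↑ = ren suc

extˢ : (ℕ → Term) → ℕ → Term
extˢ σ zero    = var zero
extˢ σ (suc i) = ↑ (σ i)

infixl 10 _[_]ˢ _[_]

_[_]ˢ : Term → (ℕ → Term) → Term
var i   [ σ ]ˢ = σ i
⊥ᵗ      [ σ ]ˢ = ⊥ᵗ
𝟎       [ σ ]ˢ = 𝟎
𝐒 t     [ σ ]ˢ = 𝐒 (t [ σ ]ˢ)
(t ≐ u) [ σ ]ˢ = t [ σ ]ˢ ≐ u [ σ ]ˢ
(¬ᵗ t)  [ σ ]ˢ = ¬ᵗ (t [ σ ]ˢ)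
(t ∨ u) [ σ ]ˢ = t [ σ ]ˢ ∨ u [ σ ]ˢ
ƛ b     [ σ ]ˢ = ƛ (b [ extˢ σ ]ˢ)
(t · u) [ σ ]ˢ = t [ σ ]ˢ · u [ σ ]ˢ
ℛ       [ σ ]ˢ = ℛ
𝒜       [ σ ]ˢ = 𝒜

-- The β-instance: index 0 is replaced and every other index drops by one.
_[_] : Term → Term → Term
b [ t ] = b [ (λ { zero → t ; (suc i) → var i }) ]ˢ

-- Substitution for the free variable v; unlike in _[_], all other free
-- variables keep their index.
[_↦_]_ : ℕ → Term → Term → Term
[ v ↦ s ] t = t [ (λ i → if i ≡ᵇ v then s else var i) ]ˢ

infixr 10 [_↦_]_

_∈fv_ : ℕ → Term → Set
i ∈fv var j   = i ≡ j
i ∈fv ⊥ᵗ      = ⊥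
i ∈fv 𝟎       = ⊥
i ∈fv 𝐒 t     = i ∈fv t
i ∈fv (t ≐ u) = i ∈fv t ⊎ i ∈fv u
i ∈fv (¬ᵗ t)  = i ∈fv t
i ∈fv (t ∨ u) = i ∈fv t ⊎ i ∈fv u
i ∈fv ƛ b     = suc i ∈fv b
i ∈fv (t · u) = i ∈fv t ⊎ i ∈fv u
i ∈fv ℛ       = ⊥
i ∈fv 𝒜       = ⊥

Closed : Term → Set
Closed t = ∀ i → ¬ (i ∈fv t)

variable
  a b c c′ f g h m p s t t′ u : Term
  v : ℕ
  Γ : List Term

data _▷_ : Term → Term → Set where
  β    : ƛ b · t ▷ b [ t ]
  ℛ-𝟎  : ℛ · g · h · 𝟎 ▷ g
  ℛ-𝐒  : ∀ n → ℛ · g · h · 𝐒 (num n) ▷ h · num n · (ℛ · g · h · num n)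
  ▷-·  : t ▷ t′ → t · u ▷ t′ · u

-- The context is a finite set, represented by a list of its elements;
-- judgments are compared by _≈_, which ignores order and repetition.
record Judgment : Set where
  constructor _⊢_
  field
    context    : List Term
    conclusion : Term

open Judgment public

_≈_ : Judgment → Judgment → Set
J ≈ K = (context J ∼[ set ] context K) × (conclusion J ≡ conclusion K)

-- A rule system relates the premises of each rule instance to its conclusion.
-- Two-way rules give two constructors.
RuleSystem : Set₁
RuleSystem = List Judgment → Judgment → Set

data RGA : RuleSystem where
  hyp     : RGA [] (c ∷ Γ ⊢ c)
  weaken  : RGA ((Γ ⊢ c) ∷ []) (a ∷ Γ ⊢ c)
  cut     : RGA ((Γ ⊢ a) ∷ (a ∷ Γ ⊢ c) ∷ []) (Γ ⊢ c)
  subst   : RGA ((Γ ⊢ c) ∷ []) (map ([ v ↦ s ]_) Γ ⊢ [ v ↦ s ] c)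

  true-to    : RGA ((Γ ⊢ a) ∷ []) (Γ ⊢ a ≐ num 1)
  true-from  : RGA ((Γ ⊢ a ≐ num 1) ∷ []) (Γ ⊢ a)
  false-to   : RGA ((Γ ⊢ ¬ᵗ a) ∷ []) (Γ ⊢ a ≐ num 0)
  false-from : RGA ((Γ ⊢ a ≐ num 0) ∷ []) (Γ ⊢ ¬ᵗ a)

  explode : RGA ((Γ ⊢ ¬ᵗ a) ∷ (Γ ⊢ a) ∷ []) (Γ ⊢ c)
  ¬¬-to   : RGA ((Γ ⊢ a) ∷ []) (Γ ⊢ ¬ᵗ ¬ᵗ a)
  ¬¬-from : RGA ((Γ ⊢ ¬ᵗ ¬ᵗ a) ∷ []) (Γ ⊢ a)

  ∨-introˡ  : RGA ((Γ ⊢ a) ∷ []) (Γ ⊢ a ∨ b)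
  ∨-introʳ  : RGA ((Γ ⊢ b) ∷ []) (Γ ⊢ a ∨ b)
  ¬∨-intro  : RGA ((Γ ⊢ ¬ᵗ a) ∷ (Γ ⊢ ¬ᵗ b) ∷ []) (Γ ⊢ ¬ᵗ (a ∨ b))
  ∨-elim    : RGA ((Γ ⊢ a ∨ b) ∷ (a ∷ Γ ⊢ c) ∷ (b ∷ Γ ⊢ c) ∷ []) (Γ ⊢ c)
  ¬∨-elimˡ  : RGA ((Γ ⊢ ¬ᵗ (a ∨ b)) ∷ []) (Γ ⊢ ¬ᵗ a)
  ¬∨-elimʳ  : RGA ((Γ ⊢ ¬ᵗ (a ∨ b)) ∷ []) (Γ ⊢ ¬ᵗ b)

  𝖭-to    : RGA ((Γ ⊢ a 𝖭) ∷ []) (Γ ⊢ a ≐ a)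
  𝖭-from  : RGA ((Γ ⊢ a ≐ a) ∷ []) (Γ ⊢ a 𝖭)
  ≐-sym   : RGA ((Γ ⊢ a ≐ b) ∷ []) (Γ ⊢ b ≐ a)
  ≐-subst : RGA ((Γ ⊢ a ≐ b) ∷ (Γ ⊢ [ v ↦ a ] p) ∷ []) (Γ ⊢ [ v ↦ b ] p)
  ≠-sym   : RGA ((Γ ⊢ a ≠ b) ∷ []) (Γ ⊢ b ≠ a)
  ≐-𝖡     : RGA ((Γ ⊢ a 𝖭) ∷ (Γ ⊢ b 𝖭) ∷ []) (Γ ⊢ (a ≐ b) 𝖡)
  ≐-𝖡-inv : RGA ((Γ ⊢ (a ≐ b) 𝖡) ∷ []) (Γ ⊢ (a 𝖭) ∧ (b 𝖭))

  𝟎-𝖭      : RGA [] (Γ ⊢ 𝟎 𝖭)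
  𝐒-𝖭-to   : RGA ((Γ ⊢ a 𝖭) ∷ []) (Γ ⊢ (𝐒 a) 𝖭)
  𝐒-𝖭-from : RGA ((Γ ⊢ (𝐒 a) 𝖭) ∷ []) (Γ ⊢ a 𝖭)
  𝐒≠𝟎      : RGA ((Γ ⊢ a 𝖭) ∷ []) (Γ ⊢ 𝐒 a ≠ 𝟎)
  𝐒≠-to    : RGA ((Γ ⊢ a ≠ b) ∷ []) (Γ ⊢ 𝐒 a ≠ 𝐒 b)
  𝐒≠-from  : RGA ((Γ ⊢ 𝐒 a ≠ 𝐒 b) ∷ []) (Γ ⊢ a ≠ b)
  𝐒-inj    : RGA ((Γ ⊢ 𝐒 a ≐ 𝐒 b) ∷ []) (Γ ⊢ a ≐ b)
  ⊥-𝖭      : RGA ((Γ ⊢ ⊥ᵗ 𝖭) ∷ []) (Γ ⊢ p)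

  induction : (∀ {q} → q ∈ Γ → ¬ (v ∈fv q)) →
    RGA ((Γ ⊢ [ v ↦ 𝟎 ] c)
         ∷ (((var v) 𝖭) ∷ c ∷ Γ ⊢ [ v ↦ 𝐒 (var v) ] c)
         ∷ (Γ ⊢ a 𝖭) ∷ [])
        (Γ ⊢ [ v ↦ a ] c)

  ▷-expand : c ▷ c′ → RGA ((Γ ⊢ c′) ∷ []) (Γ ⊢ c)
  ▷-reduce : c ▷ c′ → RGA ((Γ ⊢ c) ∷ []) (Γ ⊢ c′)
  ▷-¬      : c ▷ c′ → RGA ((Γ ⊢ ¬ᵗ c) ∷ []) (Γ ⊢ ¬ᵗ c′)
  ▷-≐      : c ▷ c′ → RGA ((Γ ⊢ c′ 𝖭) ∷ []) (Γ ⊢ c ≐ c′)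

  ℛ-step : RGA ((Γ ⊢ m 𝖭) ∷ (Γ ⊢ (h · m · (ℛ · g · h · m)) 𝖭) ∷ [])
               (Γ ⊢ ℛ · g · h · 𝐒 m ≐ h · m · (ℛ · g · h · m))

  𝒜-intro  : RGA ((((var 0) 𝖭) ∷ map ↑ Γ ⊢ ↑ f · var 0) ∷ []) (Γ ⊢ 𝒜 · f)
  𝒜-elim   : RGA ((Γ ⊢ 𝒜 · f) ∷ (Γ ⊢ a 𝖭) ∷ []) (Γ ⊢ f · a)
  ¬𝒜-intro : RGA ((Γ ⊢ ¬ᵗ (f · a)) ∷ (Γ ⊢ a 𝖭) ∷ []) (Γ ⊢ ¬ᵗ (𝒜 · f))
  ¬𝒜-elim  : RGA ((Γ ⊢ ¬ᵗ (𝒜 · f))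
                   ∷ (((var 0) 𝖭) ∷ ¬ᵗ (↑ f · var 0) ∷ map ↑ Γ ⊢ ↑ c) ∷ [])
                 (Γ ⊢ c)

data OGA : RuleSystem where
  rga : ∀ {Js J} → RGA Js J → OGA Js J
  ati : OGA ((Γ ⊢ 𝒜 · ƛ ((↑ u · var 0) 𝖡)) ∷ []) (Γ ⊢ (𝒜 · u) 𝖡)

-- A proof is a list of judgments, most recent first.
data Proof (R : RuleSystem) : List Judgment → Set where
  []     : Proof R []
  extend : ∀ {Js Ps J K} → Proof R Js →
           R Ps K → J ≈ K → All (λ P → Any (P ≈_) Js) Ps →
           Proof R (J ∷ Js)

Derivable : RuleSystem → Judgment → Set
Derivable R J = ∃ λ Js → Proof R Js × Any (J ≈_) Js

-- Every premise of a clause is about closed terms when its conclusion is, so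
-- the relation on closed terms is the restriction of this one.
data _⇓_ : Term → ℕ → Set where
  ⇓𝟎   : 𝟎 ⇓ 0
  ⇓𝐒   : ∀ {n} → t ⇓ n → 𝐒 t ⇓ suc n
  ⇓≐   : ∀ {k n} → t ⇓ k → u ⇓ n → k ≡ n → t ≐ u ⇓ 1
  ⇓≠   : ∀ {k n} → t ⇓ k → u ⇓ n → k ≢ n → t ≐ u ⇓ 0
  ⇓¬₀  : t ⇓ 1 → ¬ᵗ t ⇓ 0
  ⇓¬₁  : t ⇓ 0 → ¬ᵗ t ⇓ 1
  ⇓∨ˡ  : t ⇓ 1 → t ∨ u ⇓ 1
  ⇓∨ʳ  : u ⇓ 1 → t ∨ u ⇓ 1
  ⇓∨₀  : t ⇓ 0 → u ⇓ 0 → t ∨ u ⇓ 0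
  ⇓β   : ∀ {n} (ss : List Term) → b [ t ] ·* ss ⇓ n → ƛ b · t ·* ss ⇓ n
  ⇓ℛ𝟎  : ∀ {n} (ss : List Term) → a ⇓ 0 → g ·* ss ⇓ n →
         ℛ · g · h · a ·* ss ⇓ n
  ⇓ℛ𝐒  : ∀ {k n} (ss : List Term) → a ⇓ suc k →
         h · num k · (ℛ · g · h · num k) ·* ss ⇓ n →
         ℛ · g · h · a ·* ss ⇓ n
  ⇓𝒜₁  : (∀ k → f · num k ⇓ 1) → 𝒜 · f ⇓ 1
  ⇓𝒜₀  : ∀ k → f · num k ⇓ 0 → 𝒜 · f ⇓ 0

ω-true : Term → Set
ω-true t = Closed t × t ⇓ 1

{-# OPTIONS --safe #-}
module Submission where

-- Evaluation is deterministic, and a term with a value never evaluates once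
-- applied to arguments. Hence replacing closed subterms by closed subterms of
-- the same value preserves evaluation: a replaced subterm can never sit in head
-- position of an evaluated application. This justifies substitution of equals,
-- and lets induction and the quantifier rules pass from numerals to arbitrary
-- denoting terms. Every rule then preserves truth under all closed assignments;
-- excluded middle enters only in ati, to decide whether some instance of the
-- quantified predicate is false.

open import Defs
open import Axiom.ExcludedMiddle using (ExcludedMiddle)
open import Data.Bool using (true; false; if_then_else_; T)
open import Data.Bool.Properties using (if-float)
open import Data.Empty using (⊥-elim)
open import Data.List using (List; []; _∷_; map)
open import Data.List.Membership.Propositional using (_∈_)
open import Data.List.Relation.Unary.All as All using (All; []; _∷_)
import Data.List.Relation.Unary.All.Properties as All
open import Data.List.Relation.Unary.Any using (Any; here; there)
open import Data.Nat using (ℕ; zero; suc; _≡ᵇ_; _≟_)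
open import Data.Nat.Properties using (suc-injective; ≡ᵇ⇒≡; ≡⇒≡ᵇ)
open import Data.Product using (∃; _×_; _,_; proj₂)
open import Data.Sum using (_⊎_; inj₁; inj₂; [_,_]′)
open import Data.Unit using (tt)
open import Function using (_∘_; id)
open import Function.Bundles using (module Equivalence)
open import Level using (0ℓ)
open import Relation.Binary.PropositionalEquality
  using (_≡_; _≢_; refl; sym; trans; cong; cong₂; module ≡-Reasoning)
  renaming (subst to transport)
open import Relation.Nullary using (¬_; yes; no; contradiction)

private variable
  r w : Term
  i k n : ℕ
  σ τ : ℕ → Term

-- Substitution

-- Restricting agreement to free variables lets one induction serve `closed-subst`, where no index
-- has to agree, and `update-fresh`, where only `v` may disagree.
subst-cong-fv : ∀ t → (∀ {i} → i ∈fv t → σ i ≡ τ i) → t [ σ ]ˢ ≡ t [ τ ]ˢ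
subst-cong-fv (var i) eq = eq refl
subst-cong-fv ⊥ᵗ eq = refl
subst-cong-fv 𝟎 eq = refl
subst-cong-fv (𝐒 t) eq = cong 𝐒 (subst-cong-fv t eq)
subst-cong-fv (t ≐ u) eq =
  cong₂ _≐_ (subst-cong-fv t (eq ∘ inj₁)) (subst-cong-fv u (eq ∘ inj₂))
subst-cong-fv (¬ᵗ t) eq = cong ¬ᵗ_ (subst-cong-fv t eq)
subst-cong-fv (t ∨ u) eq =
  cong₂ _∨_ (subst-cong-fv t (eq ∘ inj₁)) (subst-cong-fv u (eq ∘ inj₂))
subst-cong-fv (ƛ b) eq =
  cong ƛ (subst-cong-fv b λ { {zero} _ → refl ; {suc i} p → cong ↑ (eq p) })
subst-cong-fv (t · u) eq =
  cong₂ _·_ (subst-cong-fv t (eq ∘ inj₁)) (subst-cong-fv u (eq ∘ inj₂))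
subst-cong-fv ℛ eq = refl
subst-cong-fv 𝒜 eq = refl

subst-cong : ∀ t → (∀ i → σ i ≡ τ i) → t [ σ ]ˢ ≡ t [ τ ]ˢ
subst-cong t eq = subst-cong-fv t (λ {i} _ → eq i)

subst-id : ∀ t → t [ var ]ˢ ≡ t
subst-id (var i) = refl
subst-id ⊥ᵗ = refl
subst-id 𝟎 = refl
subst-id (𝐒 t) = cong 𝐒 (subst-id t)
subst-id (t ≐ u) = cong₂ _≐_ (subst-id t) (subst-id u)
subst-id (¬ᵗ t) = cong ¬ᵗ_ (subst-id t)
subst-id (t ∨ u) = cong₂ _∨_ (subst-id t) (subst-id u)
subst-id (ƛ b) = cong ƛ (trans (subst-cong b λ { zero → refl ; (suc i) → refl }) (subst-id b))
subst-id (t · u) = cong₂ _·_ (subst-id t) (subst-id u)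
subst-id ℛ = refl
subst-id 𝒜 = refl

ren-subst : ∀ {ρ} t → ren ρ t [ σ ]ˢ ≡ t [ σ ∘ ρ ]ˢ
ren-subst (var i) = refl
ren-subst ⊥ᵗ = refl
ren-subst 𝟎 = refl
ren-subst (𝐒 t) = cong 𝐒 (ren-subst t)
ren-subst (t ≐ u) = cong₂ _≐_ (ren-subst t) (ren-subst u)
ren-subst (¬ᵗ t) = cong ¬ᵗ_ (ren-subst t)
ren-subst (t ∨ u) = cong₂ _∨_ (ren-subst t) (ren-subst u)
ren-subst (ƛ b) = cong ƛ (trans (ren-subst b) (subst-cong b λ { zero → refl ; (suc i) → refl }))
ren-subst (t · u) = cong₂ _·_ (ren-subst t) (ren-subst u)
ren-subst ℛ = refl
ren-subst 𝒜 = refl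

ren≡subst : ∀ {ρ} t → ren ρ t ≡ t [ var ∘ ρ ]ˢ
ren≡subst t = trans (sym (subst-id _)) (ren-subst t)

-- Reading both renamings as substitutions reduces this to composition, and `extʳ ρ ∘ suc` is
-- `suc ∘ ρ` by computation.
ren-extʳ-↑ : ∀ {ρ} t → ren (extʳ ρ) (↑ t) ≡ ↑ (ren ρ t)
ren-extʳ-↑ {ρ} t = begin
  ren (extʳ ρ) (↑ t)           ≡⟨ ren≡subst (↑ t) ⟩
  ↑ t [ var ∘ extʳ ρ ]ˢ        ≡⟨ ren-subst t ⟩
  t [ var ∘ suc ∘ ρ ]ˢ         ≡⟨ ren-subst t ⟨
  ren ρ t [ var ∘ suc ]ˢ       ≡⟨ ren≡subst (ren ρ t) ⟨
  ↑ (ren ρ t)                  ∎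
  where open ≡-Reasoning

subst-ren : ∀ {ρ} t → ren ρ (t [ σ ]ˢ) ≡ t [ ren ρ ∘ σ ]ˢ
subst-ren (var i) = refl
subst-ren ⊥ᵗ = refl
subst-ren 𝟎 = refl
subst-ren (𝐒 t) = cong 𝐒 (subst-ren t)
subst-ren (t ≐ u) = cong₂ _≐_ (subst-ren t) (subst-ren u)
subst-ren (¬ᵗ t) = cong ¬ᵗ_ (subst-ren t)
subst-ren (t ∨ u) = cong₂ _∨_ (subst-ren t) (subst-ren u)
subst-ren {σ = σ} (ƛ b) = cong ƛ (trans (subst-ren b)
  (subst-cong b λ { zero → refl ; (suc i) → ren-extʳ-↑ (σ i) }))
subst-ren (t · u) = cong₂ _·_ (subst-ren t) (subst-ren u)
subst-ren ℛ = refl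
subst-ren 𝒜 = refl

-- Under `ƛ` the substitution `extˢ τ` meets a shifted term `↑ (σ i)`: `ren-subst` absorbs the shift
-- and `subst-ren` restores it outside.
subst-subst : ∀ t → t [ σ ]ˢ [ τ ]ˢ ≡ t [ (λ i → σ i [ τ ]ˢ) ]ˢ
subst-subst (var i) = refl
subst-subst ⊥ᵗ = refl
subst-subst 𝟎 = refl
subst-subst (𝐒 t) = cong 𝐒 (subst-subst t)
subst-subst (t ≐ u) = cong₂ _≐_ (subst-subst t) (subst-subst u)
subst-subst (¬ᵗ t) = cong ¬ᵗ_ (subst-subst t)
subst-subst (t ∨ u) = cong₂ _∨_ (subst-subst t) (subst-subst u)
subst-subst {σ = σ} (ƛ b) = cong ƛ (trans (subst-subst b)
  (subst-cong b λ { zero → refl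
                  ; (suc i) → trans (ren-subst (σ i)) (sym (subst-ren (σ i))) }))
subst-subst (t · u) = cong₂ _·_ (subst-subst t) (subst-subst u)
subst-subst ℛ = refl
subst-subst 𝒜 = refl

infixr 5 _∷ˢ_

_∷ˢ_ : Term → (ℕ → Term) → ℕ → Term
(s ∷ˢ σ) zero    = s
(s ∷ˢ σ) (suc i) = σ i

extˢ-inst : ∀ b → b [ extˢ σ ]ˢ [ s ] ≡ b [ s ∷ˢ σ ]ˢ
extˢ-inst {σ = σ} b = trans (subst-subst b) (subst-cong b λ
  { zero → refl ; (suc i) → trans (ren-subst (σ i)) (subst-id (σ i)) })

inst-subst : ∀ b → b [ extˢ σ ]ˢ [ t [ σ ]ˢ ] ≡ b [ t ] [ σ ]ˢ
inst-subst b = trans (extˢ-inst b) (sym (trans (subst-subst b)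
  (subst-cong b λ { zero → refl ; (suc i) → refl })))

update : (ℕ → Term) → ℕ → Term → ℕ → Term
update σ v s i = if i ≡ᵇ v then s else σ i

-- Syntactic substitution at `v` becomes a change of the assignment at `v`, so rules that substitute
-- can be checked by evaluating one fixed term under varying assignments.
↦-subst : ∀ t → ([ v ↦ s ] t) [ σ ]ˢ ≡ t [ update σ v (s [ σ ]ˢ) ]ˢ
↦-subst {v} {σ = σ} t =
  trans (subst-subst t) (subst-cong t λ i → if-float (_[ σ ]ˢ) (i ≡ᵇ v))

update-same : ∀ v → update σ v s v ≡ s
update-same v with v ≡ᵇ v in eq
... | true  = refl
... | false = ⊥-elim (transport T eq (≡⇒≡ᵇ v v refl))

update-other : i ≢ v → update σ v s i ≡ σ i
update-other {i} {v} i≢v with i ≡ᵇ v in eq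
... | true  = contradiction (≡ᵇ⇒≡ i v (transport T (sym eq) tt)) i≢v
... | false = refl

update-update : ∀ i → update (update σ v s) v t i ≡ update σ v t i
update-update {v = v} i with i ≡ᵇ v
... | true  = refl
... | false = refl

update-fresh : ∀ t → ¬ (v ∈fv t) → t [ update σ v s ]ˢ ≡ t [ σ ]ˢ
update-fresh {σ = σ} t v∉t = subst-cong-fv t λ {i} i∈t → update-other {i} {σ = σ} λ { refl → v∉t i∈t }

-- Closed terms

fv-ren : ∀ {ρ} t → i ∈fv ren ρ t → ∃ λ j → j ∈fv t × i ≡ ρ j
fv-ren (var j) refl = j , refl , refl
fv-ren (𝐒 t) p = fv-ren t p
fv-ren (t ≐ u) (inj₁ p) = let j , q , e = fv-ren t p in j , inj₁ q , e
fv-ren (t ≐ u) (inj₂ p) = let j , q , e = fv-ren u p in j , inj₂ q , e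
fv-ren (¬ᵗ t) p = fv-ren t p
fv-ren (t ∨ u) (inj₁ p) = let j , q , e = fv-ren t p in j , inj₁ q , e
fv-ren (t ∨ u) (inj₂ p) = let j , q , e = fv-ren u p in j , inj₂ q , e
fv-ren (ƛ b) p with fv-ren b p
... | suc j , q , e = j , q , suc-injective e
fv-ren (t · u) (inj₁ p) = let j , q , e = fv-ren t p in j , inj₁ q , e
fv-ren (t · u) (inj₂ p) = let j , q , e = fv-ren u p in j , inj₂ q , e

fv-subst : ∀ t → i ∈fv t [ σ ]ˢ → ∃ λ j → i ∈fv σ j
fv-subst (var j) p = j , p
fv-subst (𝐒 t) p = fv-subst t p
fv-subst (t ≐ u) = [ fv-subst t , fv-subst u ]′
fv-subst (¬ᵗ t) p = fv-subst t p
fv-subst (t ∨ u) = [ fv-subst t , fv-subst u ]′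
fv-subst {σ = σ} (ƛ b) p with fv-subst b p
... | suc j , q with fv-ren (σ j) q
...   | _ , q′ , refl = j , q′
fv-subst (t · u) = [ fv-subst t , fv-subst u ]′

ClosedSubst : (ℕ → Term) → Set
ClosedSubst σ = ∀ i → Closed (σ i)

subst-closed : ClosedSubst σ → ∀ t → Closed (t [ σ ]ˢ)
subst-closed σ-closed t i p = let j , q = fv-subst t p in σ-closed j i q

closed-subst : Closed t → t [ σ ]ˢ ≡ t
closed-subst {t} t-closed =
  trans (subst-cong-fv t λ {i} p → ⊥-elim (t-closed i p)) (subst-id t)

closed-ren : ∀ {ρ} → Closed t → ren ρ t ≡ t
closed-ren {t} t-closed = trans (ren≡subst t) (closed-subst t-closed)

num-closed : ∀ n → Closed (num n)
num-closed (suc n) = num-closed n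

∷ˢ-closed : Closed s → ClosedSubst σ → ClosedSubst (s ∷ˢ σ)
∷ˢ-closed s-closed σ-closed zero    = s-closed
∷ˢ-closed s-closed σ-closed (suc i) = σ-closed i

update-closed : Closed s → ClosedSubst σ → ClosedSubst (update σ v s)
update-closed {v = v} s-closed σ-closed i with i ≡ᵇ v
... | true  = s-closed
... | false = σ-closed i

-- Evaluation

infix 4 _↓_ _⟶_ _~_

-- A presentation of _⇓_ by head reduction. Only constructors occur in its
-- indices (no _·*_), so derivations can be inverted by pattern matching.
mutual
  data _↓_ : Term → ℕ → Set where
    ↓𝟎    : 𝟎 ↓ 0
    ↓𝐒    : t ↓ n → 𝐒 t ↓ suc n
    ↓≐    : t ↓ n → u ↓ n → t ≐ u ↓ 1
    ↓≠    : t ↓ k → u ↓ n → k ≢ n → t ≐ u ↓ 0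
    ↓¬₀   : t ↓ 1 → ¬ᵗ t ↓ 0
    ↓¬₁   : t ↓ 0 → ¬ᵗ t ↓ 1
    ↓∨ˡ   : t ↓ 1 → t ∨ u ↓ 1
    ↓∨ʳ   : u ↓ 1 → t ∨ u ↓ 1
    ↓∨₀   : t ↓ 0 → u ↓ 0 → t ∨ u ↓ 0
    ↓step : t · u ⟶ w → w ↓ n → t · u ↓ n
    ↓𝒜₁   : (∀ k → f · num k ↓ 1) → 𝒜 · f ↓ 1
    ↓𝒜₀   : ∀ k → f · num k ↓ 0 → 𝒜 · f ↓ 0

  data _⟶_ : Term → Term → Set where
    ⟶β  : ƛ b · t ⟶ b [ t ]
    ⟶ℛ𝟎 : a ↓ 0 → ℛ · g · h · a ⟶ g
    ⟶ℛ𝐒 : a ↓ suc k → ℛ · g · h · a ⟶ h · num k · (ℛ · g · h · num k)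
    ⟶·  : t · s ⟶ w → t · s · u ⟶ w · u

⟶·* : ∀ ss → t · s ⟶ w → w ·* ss ↓ n → t · s ·* ss ↓ n
⟶·* []       st d = ↓step st d
⟶·* (_ ∷ ss) st d = ⟶·* ss (⟶· st) d

⇓⇒↓ : t ⇓ n → t ↓ n
⇓⇒↓ ⇓𝟎             = ↓𝟎
⇓⇒↓ (⇓𝐒 d)         = ↓𝐒 (⇓⇒↓ d)
⇓⇒↓ (⇓≐ d e refl)  = ↓≐ (⇓⇒↓ d) (⇓⇒↓ e)
⇓⇒↓ (⇓≠ d e k≢n)   = ↓≠ (⇓⇒↓ d) (⇓⇒↓ e) k≢n
⇓⇒↓ (⇓¬₀ d)        = ↓¬₀ (⇓⇒↓ d)
⇓⇒↓ (⇓¬₁ d)        = ↓¬₁ (⇓⇒↓ d)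
⇓⇒↓ (⇓∨ˡ d)        = ↓∨ˡ (⇓⇒↓ d)
⇓⇒↓ (⇓∨ʳ d)        = ↓∨ʳ (⇓⇒↓ d)
⇓⇒↓ (⇓∨₀ d e)      = ↓∨₀ (⇓⇒↓ d) (⇓⇒↓ e)
⇓⇒↓ (⇓β ss d)      = ⟶·* ss ⟶β (⇓⇒↓ d)
⇓⇒↓ (⇓ℛ𝟎 ss e d)   = ⟶·* ss (⟶ℛ𝟎 (⇓⇒↓ e)) (⇓⇒↓ d)
⇓⇒↓ (⇓ℛ𝐒 ss e d)   = ⟶·* ss (⟶ℛ𝐒 (⇓⇒↓ e)) (⇓⇒↓ d)
⇓⇒↓ (⇓𝒜₁ d)        = ↓𝒜₁ λ k → ⇓⇒↓ (d k)
⇓⇒↓ (⇓𝒜₀ k d)      = ↓𝒜₀ k (⇓⇒↓ d)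

mutual
  ↓⇒⇓ : t ↓ n → t ⇓ n
  ↓⇒⇓ ↓𝟎           = ⇓𝟎
  ↓⇒⇓ (↓𝐒 d)       = ⇓𝐒 (↓⇒⇓ d)
  ↓⇒⇓ (↓≐ d e)     = ⇓≐ (↓⇒⇓ d) (↓⇒⇓ e) refl
  ↓⇒⇓ (↓≠ d e k≢n) = ⇓≠ (↓⇒⇓ d) (↓⇒⇓ e) k≢n
  ↓⇒⇓ (↓¬₀ d)      = ⇓¬₀ (↓⇒⇓ d)
  ↓⇒⇓ (↓¬₁ d)      = ⇓¬₁ (↓⇒⇓ d)
  ↓⇒⇓ (↓∨ˡ d)      = ⇓∨ˡ (↓⇒⇓ d)
  ↓⇒⇓ (↓∨ʳ d)      = ⇓∨ʳ (↓⇒⇓ d)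
  ↓⇒⇓ (↓∨₀ d e)    = ⇓∨₀ (↓⇒⇓ d) (↓⇒⇓ e)
  ↓⇒⇓ (↓step st d) = ⟶-expand [] st (↓⇒⇓ d)
  ↓⇒⇓ (↓𝒜₁ d)      = ⇓𝒜₁ λ k → ↓⇒⇓ (d k)
  ↓⇒⇓ (↓𝒜₀ k d)    = ⇓𝒜₀ k (↓⇒⇓ d)

  -- `ss` collects the arguments peeled off by `⟶·`, so the head rule is reached with the whole
  -- spine that `_⇓_` contracts at once.
  ⟶-expand : ∀ ss → t ⟶ w → w ·* ss ⇓ n → t ·* ss ⇓ n
  ⟶-expand ss ⟶β       d = ⇓β ss d
  ⟶-expand ss (⟶ℛ𝟎 e)  d = ⇓ℛ𝟎 ss (↓⇒⇓ e) d
  ⟶-expand ss (⟶ℛ𝐒 e)  d = ⇓ℛ𝐒 ss (↓⇒⇓ e) d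
  ⟶-expand ss (⟶· st)  d = ⟶-expand (_ ∷ ss) st d

mutual
  -- The induction runs jointly with the one on steps, because the value of the recursion argument
  -- decides which step of `ℛ` fires.
  ↓-deterministic : t ↓ k → t ↓ n → k ≡ n
  ↓-deterministic ↓𝟎 ↓𝟎 = refl
  ↓-deterministic (↓𝐒 d) (↓𝐒 e) = cong suc (↓-deterministic d e)
  ↓-deterministic (↓≐ _ _) (↓≐ _ _) = refl
  ↓-deterministic (↓≐ d d′) (↓≠ e e′ k≢n) =
    contradiction (trans (↓-deterministic e d) (↓-deterministic d′ e′)) k≢n
  ↓-deterministic (↓≠ d d′ k≢n) (↓≐ e e′) =
    contradiction (trans (↓-deterministic d e) (↓-deterministic e′ d′)) k≢n
  ↓-deterministic (↓≠ _ _ _) (↓≠ _ _ _) = refl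
  ↓-deterministic (↓¬₀ _) (↓¬₀ _) = refl
  ↓-deterministic (↓¬₀ d) (↓¬₁ e) = sym (↓-deterministic d e)
  ↓-deterministic (↓¬₁ d) (↓¬₀ e) = sym (↓-deterministic d e)
  ↓-deterministic (↓¬₁ _) (↓¬₁ _) = refl
  ↓-deterministic (↓∨ˡ _) (↓∨ˡ _) = refl
  ↓-deterministic (↓∨ˡ _) (↓∨ʳ _) = refl
  ↓-deterministic (↓∨ˡ d) (↓∨₀ e _) = ↓-deterministic d e
  ↓-deterministic (↓∨ʳ _) (↓∨ˡ _) = refl
  ↓-deterministic (↓∨ʳ _) (↓∨ʳ _) = refl
  ↓-deterministic (↓∨ʳ d) (↓∨₀ _ e) = ↓-deterministic d e
  ↓-deterministic (↓∨₀ d _) (↓∨ˡ e) = ↓-deterministic d e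
  ↓-deterministic (↓∨₀ _ d) (↓∨ʳ e) = ↓-deterministic d e
  ↓-deterministic (↓∨₀ _ _) (↓∨₀ _ _) = refl
  ↓-deterministic (↓step st d) (↓step st′ e) with ⟶-deterministic st st′
  ... | refl = ↓-deterministic d e
  ↓-deterministic (↓step () _) (↓𝒜₁ _)
  ↓-deterministic (↓step () _) (↓𝒜₀ _ _)
  ↓-deterministic (↓𝒜₁ _) (↓step () _)
  ↓-deterministic (↓𝒜₀ _ _) (↓step () _)
  ↓-deterministic (↓𝒜₁ _) (↓𝒜₁ _) = refl
  -- The false instance `k` clashes with the same instance of `d`; the resulting `1 ≡ 0` is the goal
  -- itself.
  ↓-deterministic (↓𝒜₁ d) (↓𝒜₀ k e) = ↓-deterministic (d k) e
  ↓-deterministic (↓𝒜₀ k d) (↓𝒜₁ e) = ↓-deterministic d (e k)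
  ↓-deterministic (↓𝒜₀ _ _) (↓𝒜₀ _ _) = refl

  ⟶-deterministic : t ⟶ u → t ⟶ w → u ≡ w
  ⟶-deterministic ⟶β ⟶β = refl
  ⟶-deterministic (⟶ℛ𝟎 _) (⟶ℛ𝟎 _) = refl
  ⟶-deterministic (⟶ℛ𝟎 d) (⟶ℛ𝐒 e) with ↓-deterministic d e
  ... | ()
  ⟶-deterministic (⟶ℛ𝐒 d) (⟶ℛ𝟎 e) with ↓-deterministic d e
  ... | ()
  ⟶-deterministic (⟶ℛ𝐒 d) (⟶ℛ𝐒 e) with ↓-deterministic d e
  ... | refl = refl
  ⟶-deterministic (⟶ℛ𝟎 _) (⟶· (⟶· ()))
  ⟶-deterministic (⟶ℛ𝐒 _) (⟶· (⟶· ()))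
  ⟶-deterministic (⟶· (⟶· ())) (⟶ℛ𝟎 _)
  ⟶-deterministic (⟶· (⟶· ())) (⟶ℛ𝐒 _)
  ⟶-deterministic (⟶· st) (⟶· st′) = cong (_· _) (⟶-deterministic st st′)

-- Values in head position

data ValueApplied : Term → Set where
  value : t ↓ n → ValueApplied (t · u)
  app   : ValueApplied t → ValueApplied (t · u)

-- By determinism, a step of the application is the step that the evaluation of its head takes, so
-- the contracted head still has a value. The remaining head shapes, such as an incomplete recursor,
-- have no value or no step.
ValueApplied-⟶ : ValueApplied t → t ⟶ w → ValueApplied w
ValueApplied-⟶ (value (↓step (⟶· ()) _)) (⟶ℛ𝟎 _)
ValueApplied-⟶ (value (↓step (⟶· ()) _)) (⟶ℛ𝐒 _)
ValueApplied-⟶ (value (↓step st d)) (⟶· st′) with ⟶-deterministic st st′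
... | refl = value d
ValueApplied-⟶ (value (↓𝒜₁ _)) (⟶· ())
ValueApplied-⟶ (value (↓𝒜₀ _ _)) (⟶· ())
ValueApplied-⟶ (app (value (↓step () _))) (⟶ℛ𝟎 _)
ValueApplied-⟶ (app (app (value ()))) (⟶ℛ𝟎 _)
ValueApplied-⟶ (app (value (↓step () _))) (⟶ℛ𝐒 _)
ValueApplied-⟶ (app (app (value ()))) (⟶ℛ𝐒 _)
ValueApplied-⟶ (app va) (⟶· st) = app (ValueApplied-⟶ va st)

-- Every step of an evaluation would leave a value in head position, yet the evaluation is well
-- founded and can only end at some `𝒜 · f`, whose head has no value.
ValueApplied-diverges : ValueApplied t → ¬ (t ↓ n)
ValueApplied-diverges va (↓step st d) = ValueApplied-diverges (ValueApplied-⟶ va st) d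
ValueApplied-diverges (value ()) (↓𝒜₁ _)
ValueApplied-diverges (value ()) (↓𝒜₀ _ _)

num-↓ : ∀ n → num n ↓ n
num-↓ zero    = ↓𝟎
num-↓ (suc n) = ↓𝐒 (num-↓ n)

-- Replacing closed subterms by closed subterms of equal value

-- Closedness in `~val` keeps the relation stable under renaming and substitution, which fix closed
-- terms, also below `ƛ`.
data _~_ : Term → Term → Set where
  ~val : Closed t → Closed u → t ↓ n → u ↓ n → t ~ u
  ~var : ∀ i → var i ~ var i
  ~⊥   : ⊥ᵗ ~ ⊥ᵗ
  ~𝟎   : 𝟎 ~ 𝟎
  ~𝐒   : t ~ u → 𝐒 t ~ 𝐒 u
  ~≐   : s ~ t → u ~ w → s ≐ u ~ t ≐ w
  ~¬   : t ~ u → ¬ᵗ t ~ ¬ᵗ u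
  ~∨   : s ~ t → u ~ w → s ∨ u ~ t ∨ w
  ~ƛ   : t ~ u → ƛ t ~ ƛ u
  ~·   : s ~ t → u ~ w → s · u ~ t · w
  ~ℛ   : ℛ ~ ℛ
  ~𝒜   : 𝒜 ~ 𝒜

~-refl : t ~ t
~-refl {var i} = ~var i
~-refl {⊥ᵗ}    = ~⊥
~-refl {𝟎}     = ~𝟎
~-refl {𝐒 t}   = ~𝐒 ~-refl
~-refl {t ≐ u} = ~≐ ~-refl ~-refl
~-refl {¬ᵗ t}  = ~¬ ~-refl
~-refl {t ∨ u} = ~∨ ~-refl ~-refl
~-refl {ƛ b}   = ~ƛ ~-refl
~-refl {t · u} = ~· ~-refl ~-refl
~-refl {ℛ}     = ~ℛ
~-refl {𝒜}     = ~𝒜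

~-ren : ∀ {ρ} → t ~ u → ren ρ t ~ ren ρ u
~-ren {ρ = ρ} (~val {t} {u} t-closed u-closed d e)
  rewrite closed-ren {t} {ρ} t-closed | closed-ren {u} {ρ} u-closed = ~val t-closed u-closed d e
~-ren (~var i) = ~-refl
~-ren ~⊥       = ~⊥
~-ren ~𝟎       = ~𝟎
~-ren (~𝐒 x)   = ~𝐒 (~-ren x)
~-ren (~≐ x y) = ~≐ (~-ren x) (~-ren y)
~-ren (~¬ x)   = ~¬ (~-ren x)
~-ren (~∨ x y) = ~∨ (~-ren x) (~-ren y)
~-ren (~ƛ x)   = ~ƛ (~-ren x)
~-ren (~· x y) = ~· (~-ren x) (~-ren y)
~-ren ~ℛ       = ~ℛ
~-ren ~𝒜       = ~𝒜

-- Terms and assignments vary together because a contraction `b [ t ]` can involve replacements in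
-- both `b` and `t`.
~-subst : t ~ u → (∀ i → σ i ~ τ i) → t [ σ ]ˢ ~ u [ τ ]ˢ
~-subst {σ = σ} {τ} (~val {t} {u} t-closed u-closed d e) στ
  rewrite closed-subst {t} {σ} t-closed | closed-subst {u} {τ} u-closed = ~val t-closed u-closed d e
~-subst (~var i) στ = στ i
~-subst ~⊥       στ = ~⊥
~-subst ~𝟎       στ = ~𝟎
~-subst (~𝐒 x)   στ = ~𝐒 (~-subst x στ)
~-subst (~≐ x y) στ = ~≐ (~-subst x στ) (~-subst y στ)
~-subst (~¬ x)   στ = ~¬ (~-subst x στ)
~-subst (~∨ x y) στ = ~∨ (~-subst x στ) (~-subst y στ)
~-subst (~ƛ x)   στ = ~ƛ (~-subst x λ { zero → ~-refl ; (suc i) → ~-ren (στ i) })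
~-subst (~· x y) στ = ~· (~-subst x στ) (~-subst y στ)
~-subst ~ℛ       στ = ~ℛ
~-subst ~𝒜       στ = ~𝒜

~-inst : b ~ c → t ~ u → b [ t ] ~ c [ u ]
~-inst x y = ~-subst x λ { zero → y ; (suc i) → ~-refl }

mutual
  ~-↓ : t ~ u → t ↓ n → u ↓ n
  -- `d` is the evaluation recorded in the relation and `d′` the given one; determinism identifies
  -- their values.
  ~-↓ (~val _ _ d e) d′ = transport (_ ↓_) (↓-deterministic d d′) e
  ~-↓ ~𝟎       ↓𝟎           = ↓𝟎
  ~-↓ (~𝐒 x)   (↓𝐒 d)       = ↓𝐒 (~-↓ x d)
  ~-↓ (~≐ x y) (↓≐ d e)     = ↓≐ (~-↓ x d) (~-↓ y e)
  ~-↓ (~≐ x y) (↓≠ d e k≢n) = ↓≠ (~-↓ x d) (~-↓ y e) k≢n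
  ~-↓ (~¬ x)   (↓¬₀ d)      = ↓¬₀ (~-↓ x d)
  ~-↓ (~¬ x)   (↓¬₁ d)      = ↓¬₁ (~-↓ x d)
  ~-↓ (~∨ x y) (↓∨ˡ d)      = ↓∨ˡ (~-↓ x d)
  ~-↓ (~∨ x y) (↓∨ʳ d)      = ↓∨ʳ (~-↓ y d)
  ~-↓ (~∨ x y) (↓∨₀ d e)    = ↓∨₀ (~-↓ x d) (~-↓ y e)
  ~-↓ (~· x y) (↓step st d) with ~-⟶ x y st
  ... | inj₁ va            = contradiction (↓step st d) (ValueApplied-diverges va)
  ... | inj₂ (_ , st′ , z) = ↓step st′ (~-↓ z d)
  ~-↓ (~· ~𝒜 y) (↓𝒜₁ d)   = ↓𝒜₁ λ k → ~-↓ (~· y ~-refl) (d k)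
  ~-↓ (~· ~𝒜 y) (↓𝒜₀ k d) = ↓𝒜₀ k (~-↓ (~· y ~-refl) d)
  ~-↓ (~· (~val _ _ () _) _) (↓𝒜₁ _)
  ~-↓ (~· (~val _ _ () _) _) (↓𝒜₀ _ _)

  -- A matching step exists unless a replaced subterm is a proper prefix of the spine of `s · u`;
  -- that prefix has a value, which gives the first alternative. `~-↓` discards it, since there
  -- `s · u` is assumed to evaluate.
  ~-⟶ : s ~ t → u ~ r → s · u ⟶ w →
        ValueApplied (s · u) ⊎ ∃ λ w′ → t · r ⟶ w′ × w ~ w′
  ~-⟶ (~val _ _ d _) _ _ = inj₁ (value d)
  ~-⟶ (~ƛ x) y ⟶β = inj₂ (_ , ⟶β , ~-inst x y)
  ~-⟶ (~· (~val _ _ d _) _) _ _ = inj₁ (app (value d))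
  ~-⟶ (~· (~· (~val _ _ d _) _) _) _ (⟶ℛ𝟎 _) = inj₁ (app (app (value d)))
  ~-⟶ (~· (~· (~val _ _ d _) _) _) _ (⟶ℛ𝐒 _) = inj₁ (app (app (value d)))
  ~-⟶ (~· (~· ~ℛ g) h) a (⟶ℛ𝟎 d) = inj₂ (_ , ⟶ℛ𝟎 (~-↓ a d) , g)
  -- Both recursion arguments have value `suc k`, so both sides produce the same numeral and differ
  -- only through `g` and `h`.
  ~-⟶ (~· (~· ~ℛ g) h) a (⟶ℛ𝐒 d) =
    inj₂ (_ , ⟶ℛ𝐒 (~-↓ a d) , ~· (~· h ~-refl) (~· (~· (~· ~ℛ g) h) ~-refl))
  ~-⟶ (~· x x′) y (⟶· st) with ~-⟶ x x′ st
  ... | inj₁ va            = inj₁ (app va)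
  ... | inj₂ (_ , st′ , z) = inj₂ (_ , ⟶· st′ , ~· z y)

~-update : s ~ t → ∀ c → c [ update σ v s ]ˢ ↓ n → c [ update σ v t ]ˢ ↓ n
~-update {s} {t} {σ} {v = v} s~t c = ~-↓ (~-subst (~-refl {c}) pointwise)
  where
  pointwise : ∀ i → update σ v s i ~ update σ v t i
  pointwise i with i ≡ᵇ v
  ... | true  = s~t
  ... | false = ~-refl

-- Soundness of the rules

▷⇒⟶ : t ▷ u → t [ σ ]ˢ ⟶ u [ σ ]ˢ
▷⇒⟶ {σ = σ} (β {b} {t}) = transport (ƛ b [ σ ]ˢ · t [ σ ]ˢ ⟶_) (inst-subst b) ⟶β
▷⇒⟶ ℛ-𝟎 = ⟶ℛ𝟎 ↓𝟎
▷⇒⟶ {σ = σ} (ℛ-𝐒 n) rewrite closed-subst {num n} {σ} (num-closed n) = ⟶ℛ𝐒 (num-↓ (suc n))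
-- `⟶·` asks for a visible application as source; matching `st` against each of its forms exposes
-- one.
▷⇒⟶ (▷-· st@β)        = ⟶· (▷⇒⟶ st)
▷⇒⟶ (▷-· st@ℛ-𝟎)      = ⟶· (▷⇒⟶ st)
▷⇒⟶ (▷-· st@(ℛ-𝐒 _))  = ⟶· (▷⇒⟶ st)
▷⇒⟶ (▷-· st@(▷-· _))  = ⟶· (▷⇒⟶ st)

⟶-↓ : t ⟶ u → t ↓ n → u ↓ n
⟶-↓ st (↓step st′ d) with ⟶-deterministic st st′
... | refl = d
⟶-↓ () (↓𝒜₁ _)
⟶-↓ () (↓𝒜₀ _ _)

⟶-↓⁻ : t ⟶ u → u ↓ n → t ↓ n
⟶-↓⁻ ⟶β      = ↓step ⟶β
⟶-↓⁻ (⟶ℛ𝟎 d) = ↓step (⟶ℛ𝟎 d)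
⟶-↓⁻ (⟶ℛ𝐒 d) = ↓step (⟶ℛ𝐒 d)
⟶-↓⁻ (⟶· st) = ↓step (⟶· st)

Holds : (ℕ → Term) → List Term → Set
Holds σ = All λ h → h [ σ ]ˢ ↓ 1

-- Quantifying over all closed assignments lets a rule use its premise at another assignment, as
-- rules that substitute or open a binder must. Closedness of `c [ σ ]ˢ` is automatic, so only the
-- value is recorded.
Sound : Judgment → Set
Sound (Γ ⊢ c) = ∀ σ → ClosedSubst σ → Holds σ Γ → c [ σ ]ˢ ↓ 1

Holds-↑ : Holds σ Γ → Holds (s ∷ˢ σ) (map ↑ Γ)
Holds-↑ = All.map⁺ ∘ All.map λ {h} → transport (_↓ 1) (sym (ren-subst h))

𝖭-↓ : t ↓ n → t 𝖭 ↓ 1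
𝖭-↓ d = ↓≐ d d

rga-sound : ∀ {Ps K} → RGA Ps K → All Sound Ps → Sound K
rga-sound hyp [] σ _ (d ∷ _) = d
rga-sound weaken (p ∷ []) σ cl (_ ∷ hs) = p σ cl hs
rga-sound cut (p ∷ q ∷ []) σ cl hs = q σ cl (p σ cl hs ∷ hs)
rga-sound (subst {c = c} {s = s}) (p ∷ []) σ cl hs =
  transport (_↓ 1) (sym (↦-subst c))
    (p _ (update-closed (subst-closed cl s) cl)
       (All.map (λ {h} → transport (_↓ 1) (↦-subst h)) (All.map⁻ hs)))
rga-sound true-to (p ∷ []) σ cl hs = ↓≐ (p σ cl hs) (num-↓ 1)
rga-sound true-from (p ∷ []) σ cl hs with p σ cl hs
... | ↓≐ d (↓𝐒 ↓𝟎) = d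
rga-sound false-to (p ∷ []) σ cl hs with p σ cl hs
... | ↓¬₁ d = ↓≐ d ↓𝟎
rga-sound false-from (p ∷ []) σ cl hs with p σ cl hs
... | ↓≐ d ↓𝟎 = ↓¬₁ d
rga-sound explode (p ∷ q ∷ []) σ cl hs with p σ cl hs
... | ↓¬₁ d with ↓-deterministic d (q σ cl hs)
...   | ()
rga-sound ¬¬-to (p ∷ []) σ cl hs = ↓¬₁ (↓¬₀ (p σ cl hs))
rga-sound ¬¬-from (p ∷ []) σ cl hs with p σ cl hs
... | ↓¬₁ (↓¬₀ d) = d
rga-sound ∨-introˡ (p ∷ []) σ cl hs = ↓∨ˡ (p σ cl hs)
rga-sound ∨-introʳ (p ∷ []) σ cl hs = ↓∨ʳ (p σ cl hs)
rga-sound ¬∨-intro (p ∷ q ∷ []) σ cl hs with p σ cl hs | q σ cl hs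
... | ↓¬₁ d | ↓¬₁ e = ↓¬₁ (↓∨₀ d e)
rga-sound ∨-elim (p ∷ q ∷ r ∷ []) σ cl hs with p σ cl hs
... | ↓∨ˡ d = q σ cl (d ∷ hs)
... | ↓∨ʳ d = r σ cl (d ∷ hs)
rga-sound ¬∨-elimˡ (p ∷ []) σ cl hs with p σ cl hs
... | ↓¬₁ (↓∨₀ d _) = ↓¬₁ d
rga-sound ¬∨-elimʳ (p ∷ []) σ cl hs with p σ cl hs
... | ↓¬₁ (↓∨₀ _ d) = ↓¬₁ d
rga-sound 𝖭-to (p ∷ []) = p
rga-sound 𝖭-from (p ∷ []) = p
rga-sound ≐-sym (p ∷ []) σ cl hs with p σ cl hs
... | ↓≐ d e = ↓≐ e d
rga-sound (≐-subst {a = a} {b = b} {p = c}) (p ∷ q ∷ []) σ cl hs with p σ cl hs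
... | ↓≐ d e =
  transport (_↓ 1) (sym (↦-subst c))
    (~-update (~val (subst-closed cl a) (subst-closed cl b) d e) c
      (transport (_↓ 1) (↦-subst c) (q σ cl hs)))
rga-sound ≠-sym (p ∷ []) σ cl hs with p σ cl hs
... | ↓¬₁ (↓≠ d e k≢n) = ↓¬₁ (↓≠ e d (k≢n ∘ sym))
rga-sound ≐-𝖡 (p ∷ q ∷ []) σ cl hs with p σ cl hs | q σ cl hs
... | ↓≐ {n = k} d _ | ↓≐ {n = n} e _ with k ≟ n
...   | yes refl = ↓∨ˡ (↓≐ d e)
...   | no k≢n   = ↓∨ʳ (↓¬₁ (↓≠ d e k≢n))
rga-sound ≐-𝖡-inv (p ∷ []) σ cl hs with p σ cl hs
... | ↓∨ˡ (↓≐ d e)         = ↓¬₁ (↓∨₀ (↓¬₀ (𝖭-↓ d)) (↓¬₀ (𝖭-↓ e)))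
... | ↓∨ʳ (↓¬₁ (↓≠ d e _)) = ↓¬₁ (↓∨₀ (↓¬₀ (𝖭-↓ d)) (↓¬₀ (𝖭-↓ e)))
rga-sound 𝟎-𝖭 [] σ cl hs = 𝖭-↓ ↓𝟎
rga-sound 𝐒-𝖭-to (p ∷ []) σ cl hs with p σ cl hs
... | ↓≐ d _ = 𝖭-↓ (↓𝐒 d)
rga-sound 𝐒-𝖭-from (p ∷ []) σ cl hs with p σ cl hs
... | ↓≐ (↓𝐒 d) _ = 𝖭-↓ d
rga-sound 𝐒≠𝟎 (p ∷ []) σ cl hs with p σ cl hs
... | ↓≐ d _ = ↓¬₁ (↓≠ (↓𝐒 d) ↓𝟎 λ ())
rga-sound 𝐒≠-to (p ∷ []) σ cl hs with p σ cl hs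
... | ↓¬₁ (↓≠ d e k≢n) = ↓¬₁ (↓≠ (↓𝐒 d) (↓𝐒 e) (k≢n ∘ suc-injective))
rga-sound 𝐒≠-from (p ∷ []) σ cl hs with p σ cl hs
... | ↓¬₁ (↓≠ (↓𝐒 d) (↓𝐒 e) k≢n) = ↓¬₁ (↓≠ d e (k≢n ∘ cong suc))
rga-sound 𝐒-inj (p ∷ []) σ cl hs with p σ cl hs
... | ↓≐ (↓𝐒 d) (↓𝐒 e) = ↓≐ d e
rga-sound ⊥-𝖭 (p ∷ []) σ cl hs with p σ cl hs
... | ↓≐ () _
rga-sound (induction {Γ = Γ} {v = v} {c = c} {a = a} fresh) (p ∷ q ∷ r ∷ []) σ cl hs
  with r σ cl hs
-- `n` is the value of `a`: the claim is proved for numerals by induction, and `~-update` then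
-- trades `num n` for `a`.
... | ↓≐ {n = n} d _ =
  transport (_↓ 1) (sym (↦-subst c))
    (~-update (~val (num-closed n) (subst-closed cl a) (num-↓ n) d) c (at n))
  where
  -- The step premise interprets `𝐒 (var v)` where `v` already means `num k`, leaving two nested
  -- updates at `v`; the outer one wins.
  step : ∀ k → c [ update (update σ v (num k)) v (𝐒 (update σ v (num k) v)) ]ˢ
               ≡ c [ update σ v (num (suc k)) ]ˢ
  step k = trans (subst-cong c update-update)
                 (cong (λ s → c [ update σ v (𝐒 s) ]ˢ) (update-same {σ} v))

  at : ∀ k → c [ update σ v (num k) ]ˢ ↓ 1
  at zero    = transport (_↓ 1) (↦-subst c) (p σ cl hs)
  at (suc k) = transport (_↓ 1) (trans (↦-subst c) (step k))
    (q (update σ v (num k)) (update-closed (num-closed k) cl)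
      ( transport (λ s → s 𝖭 ↓ 1) (sym (update-same {σ} v)) (𝖭-↓ (num-↓ k))
      ∷ at k
      -- Freshness of `v` carries the hypotheses over to the updated assignment.
      ∷ All.tabulate λ {h} h∈Γ →
          transport (_↓ 1) (sym (update-fresh h (fresh h∈Γ))) (All.lookup hs h∈Γ)))
rga-sound (▷-expand st) (p ∷ []) σ cl hs = ⟶-↓⁻ (▷⇒⟶ st) (p σ cl hs)
rga-sound (▷-reduce st) (p ∷ []) σ cl hs = ⟶-↓ (▷⇒⟶ st) (p σ cl hs)
rga-sound (▷-¬ st) (p ∷ []) σ cl hs with p σ cl hs
... | ↓¬₁ d = ↓¬₁ (⟶-↓ (▷⇒⟶ st) d)
rga-sound (▷-≐ st) (p ∷ []) σ cl hs with p σ cl hs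
... | ↓≐ d _ = ↓≐ (⟶-↓⁻ (▷⇒⟶ st) d) d
rga-sound (ℛ-step {m = m}) (p ∷ q ∷ []) σ cl hs with p σ cl hs | q σ cl hs
... | ↓≐ {n = k} d _ | ↓≐ e _ =
  -- The recursor contracts to a term with `num k` in both places where `e` has `m`; `m~k` converts
  -- `e` accordingly.
  ↓≐ (↓step (⟶ℛ𝐒 (↓𝐒 d)) (~-↓ (~· (~· ~-refl m~k) (~· ~-refl m~k)) e)) e
  where
  m~k : m [ σ ]ˢ ~ num k
  m~k = ~val (subst-closed cl m) (num-closed k) d (num-↓ k)
rga-sound (𝒜-intro {f = f}) (p ∷ []) σ cl hs = ↓𝒜₁ λ k →
  transport (λ t → t · num k ↓ 1) (ren-subst f)
    (p (num k ∷ˢ σ) (∷ˢ-closed (num-closed k) cl) (𝖭-↓ (num-↓ k) ∷ Holds-↑ hs))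
rga-sound (𝒜-elim {a = a}) (p ∷ q ∷ []) σ cl hs with p σ cl hs | q σ cl hs
... | ↓step () _ | _
... | ↓𝒜₁ d | ↓≐ {n = k} e _ =
  ~-↓ (~· ~-refl (~val (num-closed k) (subst-closed cl a) (num-↓ k) e)) (d k)
rga-sound (¬𝒜-intro {a = a}) (p ∷ q ∷ []) σ cl hs with p σ cl hs | q σ cl hs
... | ↓¬₁ d | ↓≐ {n = k} e _ =
  ↓¬₁ (↓𝒜₀ k (~-↓ (~· ~-refl (~val (subst-closed cl a) (num-closed k) e (num-↓ k))) d))
rga-sound (¬𝒜-elim {f = f} {c = c}) (p ∷ q ∷ []) σ cl hs with p σ cl hs
... | ↓¬₁ (↓step () _)
-- The counterexample `k` stored in the evaluation becomes the meaning of variable zero.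
... | ↓¬₁ (↓𝒜₀ k d) = transport (_↓ 1) (ren-subst c)
  (q (num k ∷ˢ σ) (∷ˢ-closed (num-closed k) cl)
    ( 𝖭-↓ (num-↓ k)
    ∷ ↓¬₁ (transport (λ t → t · num k ↓ 0) (sym (ren-subst f)) d)
    ∷ Holds-↑ hs))

-- Excluded middle is applied once, to all `k` together; when no instance is false, `decided` leaves
-- only truth at each `k`.
𝒜-total : ExcludedMiddle 0ℓ → (∀ k → f · num k ↓ 1 ⊎ f · num k ↓ 0) → (𝒜 · f) 𝖡 ↓ 1
𝒜-total {f} em decided with em {∃ λ k → f · num k ↓ 0}
... | yes (k , d) = ↓∨ʳ (↓¬₁ (↓𝒜₀ k d))
... | no none     = ↓∨ˡ (↓𝒜₁ λ k → [ id , (λ d → contradiction (k , d) none) ]′ (decided k))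

oga-sound : ExcludedMiddle 0ℓ → ∀ {Ps K} → OGA Ps K → All Sound Ps → Sound K
oga-sound em (rga rule) = rga-sound rule
oga-sound em (ati {u = u}) (p ∷ []) σ cl hs with p σ cl hs
... | ↓step () _
... | ↓𝒜₁ instances = 𝒜-total em decided
  where
  -- The shift of `u` cancels against the variable bound by `ƛ`, so the instance at `num k` restores
  -- `u [ σ ]ˢ`.
  instance≡ : ∀ k → ↑ u [ extˢ σ ]ˢ [ num k ] ≡ u [ σ ]ˢ
  instance≡ k = trans (extˢ-inst (↑ u)) (ren-subst u)

  decided : ∀ k → u [ σ ]ˢ · num k ↓ 1 ⊎ u [ σ ]ˢ · num k ↓ 0
  decided k with instances k
  ... | ↓step ⟶β (↓∨ˡ d)       = inj₁ (transport (λ t → t · num k ↓ 1) (instance≡ k) d)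
  ... | ↓step ⟶β (↓∨ʳ (↓¬₁ d)) = inj₂ (transport (λ t → t · num k ↓ 0) (instance≡ k) d)

-- Soundness of whole proofs

Sound-resp-≈ : ∀ {J K} → J ≈ K → Sound K → Sound J
Sound-resp-≈ (same , refl) sound σ cl hs =
  -- Truth of all hypotheses depends only on membership, so order and repetition in the list are
  -- immaterial.
  sound σ cl (All.tabulate (All.lookup hs ∘ Equivalence.from same))

find-sound : ∀ {J Js} → All Sound Js → Any (J ≈_) Js → Sound J
find-sound (p ∷ _)  (here J≈K)  = Sound-resp-≈ J≈K p
find-sound (_ ∷ ps) (there any) = find-sound ps any

-- Proofs carry their newest judgment first, so the premises of each entry lie in the tail, which is
-- sound by induction.
proof-sound : ∀ {R Js} → (∀ {Ps K} → R Ps K → All Sound Ps → Sound K) →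
              Proof R Js → All Sound Js
proof-sound rules [] = []
proof-sound rules (extend proof rule J≈K premises) =
  Sound-resp-≈ J≈K (rules rule (All.map (find-sound sounds) premises)) ∷ sounds
  where sounds = proof-sound rules proof

theorem4p1 : ExcludedMiddle 0ℓ →
    (Γ : List Term) (c : Term) → Derivable OGA (Γ ⊢ c) →
    (σ : ℕ → Term) → (∀ i → Closed (σ i)) →
    (∀ {h} → h ∈ Γ → ω-true (h [ σ ]ˢ)) → ω-true (c [ σ ]ˢ)
theorem4p1 em Γ c (_ , proof , found) σ σ-closed hyps =
  subst-closed σ-closed c ,
  ↓⇒⇓ (find-sound (proof-sound (oga-sound em) proof) found σ σ-closed
        (All.tabulate (⇓⇒↓ ∘ proj₂ ∘ hyps)))
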